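{- The following hold. (a) Let $n \equiv 0 \pmod 2$ and $n \ge 4$. If $F_1$ and $F_2$ are graphs on a common set of $n$ vertices, both isomorphic to the cycle $C_n$, then $\gamma_{\rm sd}(F_1,F_2) \le n/2$. Likewise, if $F_1$ and $F_2$ are graphs on a common set of $n$ vertices, both isomorphic to the path $P_n$, then $\gamma_{\rm sd}(F_1,F_2) \le n/2$. (b) Let $n \equiv 1 \pmod 2$ and $n \ge 5$. If $F_1$ and $F_2$ are graphs on a common set of $n$ vertices, both isomorphic to the cycle $C_n$, then $\gamma_{\rm sd}(F_1,F_2) \le (n+1)/2$.
   Context: All graphs are finite and simple; $C_n$ and $P_n$ denote the cycle and the path on $n$ vertices. Given graphs $F_1, F_2$ (called factors; not necessarily edge-disjoint) with common vertex set $V$, a set $S \subseteq V$ is a simultaneous dominating set if for each $i \in \{1,2\}$ every vertex not in $S$ is adjacent in $F_i$ to some vertex of $S$. The simultaneous domination number $\gamma_{\rm sd}(F_1,F_2)$ is the minimum cardinality of a simultaneous dominating set. -}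

module Defs where

open import Data.Empty.Irrelevant using (⊥-elim)
open import Data.Fin.Base using (Fin; toℕ)
import Data.Fin.Properties as Fin
open import Data.Fin.Subset using (Subset; _∈_; _∉_; ∣_∣; ⊤)
open import Data.Fin.Subset.Properties using (_∈?_; ∈⊤; anySubset?)
open import Data.Nat.Base using (ℕ; suc; _≤_; _<_; s≤s)
open import Data.Nat.Induction using (Acc; acc; <-wellFounded)
open import Data.Nat.Properties using (_≟_; _<?_; ≮⇒≥; 1+n≢n)
open import Data.Product.Base using (∃-syntax; _×_; _,_; proj₁)
open import Data.Sum.Base using (_⊎_; inj₁; inj₂; swap)
open import Function.Base using (case_of_)
open import Function.Bundles using (_↔_; _⇔_; Inverse)
open import Level using (0ℓ)
open import Relation.Binary.Core using (Rel)
open import Relation.Binary.Definitions using (Symmetric; Irreflexive; Decidable)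
open import Relation.Binary.PropositionalEquality using (_≡_; refl; sym; trans; cong)
open import Relation.Nullary.Decidable using (yes; no; ¬?; _×-dec_; _⊎-dec_; _→-dec_)
open import Relation.Nullary.Negation using (¬_; contradiction)
import Relation.Unary as U

-- Adjacency is decidable, as it is classically; this makes the minimum
-- defining γsd below exist constructively.
record Graph (V : Set) : Set₁ where
  field
    Adj        : Rel V 0ℓ
    adj-sym    : Symmetric Adj
    adj-irrefl : Irreflexive _≡_ Adj
    adj?       : Decidable Adj

open Graph public

infix 4 _≅_

record _≅_ {V W : Set} (G : Graph V) (H : Graph W) : Set where
  field
    bijection : V ↔ W
    adjacency : ∀ u v → Adj G u v ⇔ Adj H (Inverse.to bijection u) (Inverse.to bijection v)

Consecutive : ∀ {n} → Rel (Fin n) 0ℓ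
Consecutive i j = suc (toℕ i) ≡ toℕ j

consecutive? : ∀ {n} → Decidable (Consecutive {n})
consecutive? i j = suc (toℕ i) ≟ toℕ j

P : (n : ℕ) → Graph (Fin n)
P n .Adj i j                  = Consecutive i j ⊎ Consecutive j i
P n .adj-sym                  = swap
P n .adj-irrefl refl (inj₁ e) = 1+n≢n e
P n .adj-irrefl refl (inj₂ e) = 1+n≢n e
P n .adj? i j                 = consecutive? i j ⊎-dec consecutive? j i

CyclicallyConsecutive : ∀ {n} → Rel (Fin n) 0ℓ
CyclicallyConsecutive {n} i j = Consecutive i j ⊎ (suc (toℕ i) ≡ n × toℕ j ≡ 0)

cyclicallyConsecutive? : ∀ {n} → Decidable (CyclicallyConsecutive {n})
cyclicallyConsecutive? {n} i j =
  consecutive? i j ⊎-dec ((suc (toℕ i) ≟ n) ×-dec (toℕ j ≟ 0))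

cyclicallyConsecutive-irrefl :
  ∀ {n} → .(3 ≤ n) → (i : Fin n) → ¬ CyclicallyConsecutive i i
cyclicallyConsecutive-irrefl 3≤n i (inj₁ e) = 1+n≢n e
cyclicallyConsecutive-irrefl {n} 3≤n i (inj₂ (last , first)) =
  case trans (sym last) (cong suc first) of λ { refl → ⊥-elim (3≰1 3≤n) }
  where
  3≰1 : ¬ (3 ≤ 1)
  3≰1 (s≤s ())

C : (n : ℕ) → .(3 ≤ n) → Graph (Fin n)
C n 3≤n .Adj i j                      = CyclicallyConsecutive i j ⊎ CyclicallyConsecutive j i
C n 3≤n .adj-sym                      = swap
C n 3≤n .adj-irrefl {i} refl (inj₁ e) = cyclicallyConsecutive-irrefl 3≤n i e
C n 3≤n .adj-irrefl {i} refl (inj₂ e) = cyclicallyConsecutive-irrefl 3≤n i e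
C n 3≤n .adj? i j                     = cyclicallyConsecutive? i j ⊎-dec cyclicallyConsecutive? j i

module _ {n : ℕ} where

  Dominating : Graph (Fin n) → Subset n → Set
  Dominating F S = ∀ v → v ∉ S → ∃[ u ] (u ∈ S × Adj F v u)

  dominating? : ∀ F → U.Decidable (Dominating F)
  dominating? F S =
    Fin.all? λ v → ¬? (v ∈? S) →-dec Fin.any? λ u → (u ∈? S) ×-dec adj? F v u

  SimultaneouslyDominating : (F₁ F₂ : Graph (Fin n)) → Subset n → Set
  SimultaneouslyDominating F₁ F₂ S = Dominating F₁ S × Dominating F₂ S

  simultaneouslyDominating? : ∀ F₁ F₂ → U.Decidable (SimultaneouslyDominating F₁ F₂)
  simultaneouslyDominating? F₁ F₂ S = dominating? F₁ S ×-dec dominating? F₂ S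

  IsMinimumCardinality : (Subset n → Set) → ℕ → Set
  IsMinimumCardinality Q k = (∃[ S ] (Q S × ∣ S ∣ ≡ k)) × (∀ S → Q S → k ≤ ∣ S ∣)

  minimumCardinality : ∀ {Q : Subset n → Set} → U.Decidable Q → ∃[ S ] Q S →
                       ∃[ k ] IsMinimumCardinality Q k
  minimumCardinality {Q} Q? (S₀ , q₀) = descend S₀ q₀ (<-wellFounded ∣ S₀ ∣)
    where
    descend : ∀ S → Q S → Acc _<_ ∣ S ∣ → ∃[ k ] IsMinimumCardinality Q k
    descend S q (acc rec) with anySubset? (λ T → Q? T ×-dec (∣ T ∣ <? ∣ S ∣))
    ... | yes (T , q′ , T<S) = descend T q′ (rec T<S)
    ... | no  none           =
      ∣ S ∣ , (S , q , refl) , λ T q′ → ≮⇒≥ λ T<S → none (T , q′ , T<S)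

  ⊤-dominating : ∀ F → Dominating F ⊤
  ⊤-dominating F v v∉⊤ = contradiction ∈⊤ v∉⊤

  γsd-exists : ∀ F₁ F₂ → ∃[ k ] IsMinimumCardinality (SimultaneouslyDominating F₁ F₂) k
  γsd-exists F₁ F₂ = minimumCardinality (simultaneouslyDominating? F₁ F₂)
                       (⊤ , ⊤-dominating F₁ , ⊤-dominating F₂)

  γsd : (F₁ F₂ : Graph (Fin n)) → ℕ
  γsd F₁ F₂ = proj₁ (γsd-exists F₁ F₂)

{-# OPTIONS --safe #-}
-- A graph on an even number of vertices with a Hamiltonian path has a perfect
-- matching. The union of two perfect matchings is bipartite, and both colour
-- classes of a proper 2-colouring are simultaneously dominating of size n/2.
-- The 2-colouring is found by switching edges of the second matching until it
-- coincides with the first; each switch is undone by at most a colour swap.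
-- If n is odd, prolong both Hamiltonian paths by a common new end vertex and
-- take the colour class that avoids it.
module Submission where

open import Defs
open import Algebra.Definitions using (Involutive)
open import Data.Bool.Base using (Bool; true; false; not; if_then_else_)
open import Data.Bool.Properties as Bool using (not-involutive; ¬-not)
open import Data.Fin.Base using (Fin; zero; suc)
open import Data.Fin.Permutation as Perm using (Permutation; _⟨$⟩ʳ_; _⟨$⟩ˡ_; lift₀)
import Data.Fin.Permutation.Components as PC
open import Data.Fin.Properties using (_≟_; _<?_; <-cmp)
open import Data.Fin.Subset using (Subset; _∈_; ∣_∣)
open import Data.List.Base using (List; []; _∷_; allFin)
import Data.List.Membership.Propositional as List
open import Data.List.Membership.Propositional.Properties using (∈-allFin)
open import Data.List.Relation.Unary.Any using (here; there)
open import Data.Nat.Base using (ℕ; zero; suc; _+_; _*_; _≤_; _/_; _%_)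
open import Data.Nat.DivMod using (m*n/n≡m)
open import Data.Nat.Properties
  using (m+n≤o⇒n≤o; +-0-commutativeMonoid; +-comm; +-identityʳ; *-comm; ≤-reflexive; ≤-trans; suc-injective)
open import Data.Product.Base using (∃-syntax; _×_; _,_; proj₂)
open import Data.Sum.Base using (inj₁; inj₂) renaming (map to ⊎-map)
open import Data.Vec.Base using (tabulate)
open import Data.Vec.Properties using (lookup∘tabulate; lookup⇒[]=)
open import Function.Base using (_∘_)
open import Function.Bundles using (Equivalence)
open import Relation.Binary.Definitions using (tri<; tri≈; tri>)
open import Relation.Binary.PropositionalEquality
  using (_≡_; _≢_; _≗_; refl; sym; trans; cong; subst; module ≡-Reasoning)
open import Relation.Nullary.Decidable using (Dec; does; yes; no; dec-true; dec-false)
open import Relation.Nullary.Negation using (contradiction)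

open import Algebra.Properties.CommutativeMonoid.Sum +-0-commutativeMonoid
  using (sum; sum-permute; sum-cong-≗; ∑-distrib-+)

private
  variable
    m n : ℕ

-- Perfect matchings as fixed-point-free involutions

-- Encodes a perfect matching of the vertex set: `f` sends every vertex to the other end of its
-- matching edge.
record IsFixedPointFreeInvolution (f : Fin n → Fin n) : Set where
  field
    involutive     : Involutive _≡_ f
    fixedPointFree : ∀ v → f v ≢ v

  injective : ∀ {u v} → f u ≡ f v → u ≡ v
  injective {u} {v} e = trans (sym (involutive u)) (trans (cong f e) (involutive v))

  flip-≡ : ∀ {u v} → f u ≡ v → f v ≡ u
  flip-≡ {u} e = trans (cong f (sym e)) (involutive u)

open IsFixedPointFreeInvolution

conjugate : Permutation m n → (Fin n → Fin n) → Fin m → Fin m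
conjugate π f v = π ⟨$⟩ˡ f (π ⟨$⟩ʳ v)

conjugate-isFixedPointFreeInvolution :
  (π : Permutation m n) {f : Fin n → Fin n} →
  IsFixedPointFreeInvolution f → IsFixedPointFreeInvolution (conjugate π f)
conjugate-isFixedPointFreeInvolution π {f} isF = record
  { involutive     = λ v → trans (cong (λ u → π ⟨$⟩ˡ f u) (Perm.inverseʳ π))
                                 (trans (cong (π ⟨$⟩ˡ_) (involutive isF _)) (Perm.inverseˡ π))
  ; fixedPointFree = λ v e → fixedPointFree isF _
                               (trans (sym (Perm.inverseʳ π)) (cong (π ⟨$⟩ʳ_) e))
  }

transpose-left : (i j : Fin n) → PC.transpose i j i ≡ j
transpose-left i j rewrite dec-true (i ≟ i) refl = refl

transpose-right : (i j : Fin n) → PC.transpose i j j ≡ i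
transpose-right i j with j ≟ i
... | yes j≡i = j≡i
... | no  _ rewrite dec-true (j ≟ j) refl = refl

transpose-fixes : (i j : Fin n) {k : Fin n} → k ≢ i → k ≢ j → PC.transpose i j k ≡ k
transpose-fixes i j {k} k≢i k≢j
  rewrite dec-false (k ≟ i) k≢i | dec-false (k ≟ j) k≢j = refl

-- Proper 2-colourings of a matching

Alternates : (Fin n → Bool) → (Fin n → Fin n) → Set
Alternates c f = ∀ v → c (f v) ≡ not (c v)

alternates-≗ : {c d : Fin n → Bool} {f : Fin n → Fin n} →
               c ≗ d → Alternates c f → Alternates d f
alternates-≗ {f = f} c≗d alt v =
  trans (sym (c≗d (f v))) (trans (alt v) (cong not (c≗d v)))

alternates-conjugate : (π : Permutation m n) (f : Fin n → Fin n) {c : Fin m → Bool} →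
                       Alternates c (conjugate π f) → Alternates (c ∘ (π ⟨$⟩ˡ_)) f
alternates-conjugate π f {c} alt v =
  trans (cong (λ u → c (π ⟨$⟩ˡ f u)) (sym (Perm.inverseʳ π))) (alt (π ⟨$⟩ˡ v))

-- Switching and unswitching matching edges

-- Conjugating b by the transposition of a x and b x switches the b-edges
-- {x , b x} and {a x , b (a x)} to {x , a x} and {b x , b (a x)}.
switch : (a b : Fin n → Fin n) → Fin n → Fin n → Fin n
switch a b x = conjugate (Perm.transpose (a x) (b x)) b

module _ {a b : Fin n → Fin n}
         (isA : IsFixedPointFreeInvolution a) (isB : IsFixedPointFreeInvolution b)
         (x : Fin n) where

  private
    y w z : Fin n
    y = a x
    w = b x
    z = b y

    x≢y : x ≢ y
    x≢y = fixedPointFree isA x ∘ sym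

    x≢w : x ≢ w
    x≢w = fixedPointFree isB x ∘ sym

  switch-matches : switch a b x x ≡ a x
  switch-matches =
    trans (cong (PC.transpose w y ∘ b) (transpose-fixes y w x≢y x≢w)) (transpose-left w y)

  switch-fixes : ∀ {v} → v ≢ y → v ≢ w → b v ≢ y → b v ≢ w → switch a b x v ≡ b v
  switch-fixes v≢y v≢w bv≢y bv≢w =
    trans (cong (PC.transpose w y ∘ b) (transpose-fixes y w v≢y v≢w))
          (transpose-fixes w y bv≢w bv≢y)

  -- A `b`-edge affected by the switch meets `{x , y , w}`. If it is also an `a`-edge, it either
  -- contains `x`, and is then `{x , y}`, which the switch keeps, or contains `y`, whose `a`-partner
  -- is `x` again.
  switch-preserves-agreement : ∀ {v} → v ≢ x → b v ≡ a v → switch a b x v ≡ a v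
  switch-preserves-agreement {v} v≢x bv≡av = cases (v ≟ y) (v ≟ w)
    where
    cases : Dec (v ≡ y) → Dec (v ≡ w) → switch a b x v ≡ a v
    cases (yes refl) _ = begin
      PC.transpose w y (b (PC.transpose y w y))  ≡⟨ cong (PC.transpose w y ∘ b) (transpose-left y w) ⟩
      PC.transpose w y (b w)                     ≡⟨ cong (PC.transpose w y) (involutive isB x) ⟩
      PC.transpose w y x                         ≡⟨ transpose-fixes w y x≢w x≢y ⟩
      x                                          ≡⟨ involutive isA x ⟨
      a y                                        ∎
      where open ≡-Reasoning
    cases (no v≢y) (yes refl) =
      -- Here the common edge would be `{w , x}`; as an `a`-edge it forces `w ≡ y`.
      contradiction (flip-≡ isA (trans (sym bv≡av) (involutive isB x))) (v≢y ∘ sym)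
    cases (no v≢y) (no v≢w) =
      trans (switch-fixes v≢y v≢w
               (λ e → v≢x (injective isA (trans (sym bv≡av) e)))
               (λ e → v≢x (injective isB e)))
            bv≡av

  module _ {c : Fin n → Bool} (altA : Alternates c a) (altB : Alternates c (switch a b x)) where

    -- The transposition of `y` and `w` exchanges equally coloured vertices, so it leaves `c`
    -- unchanged and undoing the conjugation costs nothing.
    alternates-unswitched : c y ≡ c w → Alternates c b
    alternates-unswitched cy≡cw =
      alternates-≗ unchanged (alternates-conjugate (Perm.transpose y w) b altB)
      where
      unchanged : c ∘ PC.transpose w y ≗ c
      unchanged v with v ≟ w
      ... | yes refl = cy≡cw
      ... | no  _ with v ≟ y
      ...   | yes refl = sym cy≡cw
      ...   | no  _    = refl

    -- c is monochromatic on {x , w} and on {y , z}; exchanging the colours of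
    -- x and y repairs both b-edges and keeps the a-edge {x , y} bichromatic.
    module _ (cy≢cw : c y ≢ c w) where

      private
        d : Fin n → Bool
        d = c ∘ PC.transpose x y

        -- The colours exclude the degenerate case of a common edge at `x`, so `x`, `y`, `w`, `z`
        -- are four distinct vertices.
        w≢y : w ≢ y
        w≢y w≡y = cy≢cw (cong c (sym w≡y))

        z≢x : z ≢ x
        z≢x = w≢y ∘ flip-≡ isB

        z≢w : z ≢ w
        z≢w = x≢y ∘ sym ∘ injective isB

        dx : d x ≡ c y
        dx = cong c (transpose-left x y)

        dy : d y ≡ c x
        dy = cong c (transpose-right x y)

        d-fixed : ∀ {v} → v ≢ x → v ≢ y → d v ≡ c v
        d-fixed v≢x v≢y = cong c (transpose-fixes x y v≢x v≢y)

        cw : c w ≡ not (c y)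
        cw = ¬-not (cy≢cw ∘ sym)

        cz : c z ≡ not (c x)
        cz = begin
          -- The switched matching contains the edge `{w , z}`.
          c z                 ≡⟨ cong c switched ⟨
          c (switch a b x w)  ≡⟨ altB w ⟩
          not (c w)           ≡⟨ cong not cw ⟩
          not (not (c y))     ≡⟨ cong not (altA y) ⟨
          not (c (a y))       ≡⟨ cong (not ∘ c) (involutive isA x) ⟩
          not (c x)           ∎
          where
          open ≡-Reasoning
          switched : switch a b x w ≡ z
          switched = trans (cong (PC.transpose w y ∘ b) (transpose-right y w))
                           (transpose-fixes w y z≢w (fixedPointFree isB y))

        at-x : d w ≡ not (d x)
        at-x = trans (d-fixed (x≢w ∘ sym) w≢y) (trans cw (cong not (sym dx)))

        at-y : d z ≡ not (d y)
        at-y = trans (d-fixed z≢x (fixedPointFree isB y)) (trans cz (cong not (sym dy)))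

        -- Being bichromatic is symmetric in the two ends of a `b`-edge, so edges ending in `x` or
        -- `y` reduce to `at-x` and `at-y`.
        reversed : ∀ {u v} → b v ≡ u → d (b u) ≡ not (d u) → d (b v) ≡ not (d v)
        reversed {v = v} refl e = begin
          d (b v)              ≡⟨ not-involutive _ ⟨
          not (not (d (b v)))  ≡⟨ cong not e ⟨
          not (d (b (b v)))    ≡⟨ cong (not ∘ d) (involutive isB v) ⟩
          not (d v)            ∎
          where open ≡-Reasoning

      swapped-alternates-b : Alternates d b
      swapped-alternates-b v = cases (v ≟ x) (v ≟ y) (b v ≟ x) (b v ≟ y)
        where
        cases : Dec (v ≡ x) → Dec (v ≡ y) → Dec (b v ≡ x) → Dec (b v ≡ y) →
                d (b v) ≡ not (d v)
        cases (yes refl) _          _       _       = at-x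
        cases (no _)     (yes refl) _       _       = at-y
        cases (no _)     (no _)     (yes e) _       = reversed e at-x
        cases (no _)     (no _)     (no _)  (yes e) = reversed e at-y
        -- A `b`-edge avoiding `x` and `y` also avoids their partners `w` and `z`; neither the
        -- switch nor the recolouring touches it.
        cases (no v≢x)   (no v≢y)   (no bv≢x) (no bv≢y) = begin
          d (b v)             ≡⟨ d-fixed bv≢x bv≢y ⟩
          c (b v)             ≡⟨ cong c (switch-fixes v≢y v≢w bv≢y bv≢w) ⟨
          c (switch a b x v)  ≡⟨ altB v ⟩
          not (c v)           ≡⟨ cong not (d-fixed v≢x v≢y) ⟨
          not (d v)           ∎
          where
          open ≡-Reasoning
          v≢w : v ≢ w
          v≢w refl = bv≢x (involutive isB x)
          bv≢w : b v ≢ w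
          bv≢w = v≢x ∘ injective isB

      swapped-alternates-a : Alternates d a
      swapped-alternates-a v = cases (v ≟ x) (v ≟ y)
        where
        cases : Dec (v ≡ x) → Dec (v ≡ y) → d (a v) ≡ not (d v)
        cases (yes refl) _ = begin
          d y          ≡⟨ dy ⟩
          c x          ≡⟨ cong c (involutive isA x) ⟨
          c (a y)      ≡⟨ altA y ⟩
          not (c y)    ≡⟨ cong not dx ⟨
          not (d x)    ∎
          where open ≡-Reasoning
        cases (no _) (yes refl) = begin
          d (a y)      ≡⟨ cong d (involutive isA x) ⟩
          d x          ≡⟨ dx ⟩
          c y          ≡⟨ altA x ⟩
          not (c x)    ≡⟨ cong not dy ⟨
          not (d y)    ∎
          where open ≡-Reasoning
        cases (no v≢x) (no v≢y) = begin
          d (a v)      ≡⟨ d-fixed (v≢y ∘ sym ∘ flip-≡ isA) (v≢x ∘ injective isA) ⟩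
          c (a v)      ≡⟨ altA v ⟩
          not (c v)    ≡⟨ cong not (d-fixed v≢x v≢y) ⟨
          not (d v)    ∎
          where open ≡-Reasoning

    unswitch : ∃[ d ] (Alternates d a × Alternates d b)
    unswitch with c y Bool.≟ c w
    ... | yes cy≡cw = c , altA , alternates-unswitched cy≡cw
    ... | no  cy≢cw = _ , swapped-alternates-a cy≢cw , swapped-alternates-b cy≢cw

-- A common 2-colouring of two matchings

-- The colouring for a single matching: the smaller end of each edge is `true`.
isAscent : (Fin n → Fin n) → Fin n → Bool
isAscent a v = does (v <? a v)

ascent-alternates : {a : Fin n → Fin n} → IsFixedPointFreeInvolution a →
                    Alternates (isAscent a) a
ascent-alternates {a = a} isA v rewrite involutive isA v with <-cmp v (a v)
... | tri< v<av _ av≮v rewrite dec-true (v <? a v) v<av | dec-false (a v <? v) av≮v = refl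
... | tri≈ _ v≡av _    = contradiction (sym v≡av) (fixedPointFree isA v)
... | tri> v≮av _ av<v rewrite dec-false (v <? a v) v≮av | dec-true (a v <? v) av<v = refl

-- Induction on a list `vs` containing all vertices where `b` may differ from `a`. Switching at the
-- head `x` creates agreement there and destroys none elsewhere; `unswitch` carries the colouring
-- back. With no vertices left, one colouring of `a` serves both.
alternating-outside : {a b : Fin n → Fin n} →
  IsFixedPointFreeInvolution a → IsFixedPointFreeInvolution b →
  (vs : List (Fin n)) → (∀ {v} → v List.∉ vs → b v ≡ a v) →
  ∃[ c ] (Alternates c a × Alternates c b)
alternating-outside {a = a} isA isB [] agree =
  isAscent a , ascent-alternates isA ,
  λ v → trans (cong (isAscent a) (agree λ ())) (ascent-alternates isA v)
alternating-outside {a = a} {b} isA isB (x ∷ vs) agree =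
  let _ , altA , altB = alternating-outside isA
                          (conjugate-isFixedPointFreeInvolution (Perm.transpose (a x) (b x)) isB)
                          vs agree′
  in unswitch isA isB x altA altB
  where
  agree′ : ∀ {v} → v List.∉ vs → switch a b x v ≡ a v
  agree′ {v} v∉vs with v ≟ x
  ... | yes refl = switch-matches isA isB x
  ... | no  v≢x  = switch-preserves-agreement isA isB x v≢x
                     (agree λ { (here v≡x) → v≢x v≡x ; (there v∈vs) → v∉vs v∈vs })

alternating : {a b : Fin n → Fin n} →
  IsFixedPointFreeInvolution a → IsFixedPointFreeInvolution b →
  ∃[ c ] (Alternates c a × Alternates c b)
alternating {n} isA isB =
  alternating-outside isA isB (allFin n) (λ {v} v∉ → contradiction (∈-allFin v) v∉)

-- Size of a colour class

indicator : Bool → ℕ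
indicator b = if b then 1 else 0

∣tabulate∣≡sum : (c : Fin n → Bool) → ∣ tabulate c ∣ ≡ sum (indicator ∘ c)
∣tabulate∣≡sum {zero}  c = refl
∣tabulate∣≡sum {suc n} c with c zero
... | true  = cong suc (∣tabulate∣≡sum (c ∘ suc))
... | false = ∣tabulate∣≡sum (c ∘ suc)

sum-ones : ∀ n → sum {n} (λ _ → 1) ≡ n
sum-ones zero    = refl
sum-ones (suc n) = cong suc (sum-ones n)

-- Double counting: reindexing the sum along the permutation `a` leaves it unchanged, and `v` and
-- `a v` together contribute exactly one.
alternating-sum : {a : Fin n → Fin n} {c : Fin n → Bool} →
                  IsFixedPointFreeInvolution a → Alternates c a →
                  sum (indicator ∘ c) * 2 ≡ n
alternating-sum {n} {a} {c} isA alt = begin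
  s * 2                                                   ≡⟨ *-comm s 2 ⟩
  s + (s + 0)                                             ≡⟨ cong (s +_) (+-identityʳ s) ⟩
  s + s                                                   ≡⟨ cong (s +_) (sum-permute (indicator ∘ c) π) ⟩
  s + sum {n} (λ v → indicator (c (a v)))                 ≡⟨ ∑-distrib-+ (indicator ∘ c) _ ⟨
  sum {n} (λ v → indicator (c v) + indicator (c (a v)))   ≡⟨ sum-cong-≗ one ⟩
  sum {n} (λ _ → 1)                                       ≡⟨ sum-ones n ⟩
  n                                                       ∎
  where
  open ≡-Reasoning
  s = sum (indicator ∘ c)
  π = Perm.permutation a a (involutive isA) (involutive isA)
  complement : ∀ b → indicator b + indicator (not b) ≡ 1
  complement true  = refl
  complement false = refl
  one : ∀ v → indicator (c v) + indicator (c (a v)) ≡ 1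
  one v = trans (cong (λ t → indicator (c v) + indicator t) (alt v)) (complement (c v))

-- Perfect matching of a path of even order

-- The pairing 0–1, 2–3, …; the last index is fixed if n is odd.
partner : Fin n → Fin n
partner {suc zero}    zero          = zero
partner {suc (suc n)} zero          = suc zero
partner {suc (suc n)} (suc zero)    = zero
partner {suc (suc n)} (suc (suc i)) = suc (suc (partner i))

partner-involutive : Involutive _≡_ (partner {n})
partner-involutive {suc zero}    zero          = refl
partner-involutive {suc (suc n)} zero          = refl
partner-involutive {suc (suc n)} (suc zero)    = refl
partner-involutive {suc (suc n)} (suc (suc i)) = cong (λ j → suc (suc j)) (partner-involutive i)

P-suc : ∀ {i j : Fin n} → Adj (P n) i j → Adj (P (suc n)) (suc i) (suc j)
P-suc = ⊎-map (cong suc) (cong suc)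

P-unsuc : ∀ {i j : Fin n} → Adj (P (suc n)) (suc i) (suc j) → Adj (P n) i j
P-unsuc = ⊎-map suc-injective suc-injective

-- Evenness excludes the fixed last index, since `1 % 2 ≡ 0` is empty; it passes to the recursive
-- call because `suc (suc n) % 2` reduces to `n % 2`.
partner-adjacent : n % 2 ≡ 0 → (i : Fin n) → Adj (P n) i (partner i)
partner-adjacent {suc (suc n)} even zero          = inj₁ refl
partner-adjacent {suc (suc n)} even (suc zero)    = inj₂ refl
partner-adjacent {suc (suc n)} even (suc (suc i)) = P-suc (P-suc (partner-adjacent even i))

partner-isFixedPointFreeInvolution : n % 2 ≡ 0 → IsFixedPointFreeInvolution (partner {n})
partner-isFixedPointFreeInvolution {n} even = record
  { involutive     = partner-involutive
  ; fixedPointFree = λ v e → adj-irrefl (P n) (sym e) (partner-adjacent even v)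
  }

conjugate-partner-adjacent : n % 2 ≡ 0 → (π : Permutation m n) (v : Fin m) →
  Adj (P n) (π ⟨$⟩ʳ v) (π ⟨$⟩ʳ conjugate π partner v)
conjugate-partner-adjacent {n} even π v =
  subst (Adj (P n) (π ⟨$⟩ʳ v)) (sym (Perm.inverseʳ π)) (partner-adjacent even (π ⟨$⟩ʳ v))

-- Hamiltonian paths in the factors

-- `π` gives each vertex its position along the path. Edges of `F` outside the path are allowed,
-- which covers the closing edge of a cycle.
HamiltonianPath : Graph (Fin n) → Set
HamiltonianPath {n} F =
  ∃[ π ] (∀ {u v} → Adj (P n) (_⟨$⟩ʳ_ {n} {n} π u) (π ⟨$⟩ʳ v) → Adj F u v)

≅P⇒hamiltonianPath : {F : Graph (Fin n)} → F ≅ P n → HamiltonianPath F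
≅P⇒hamiltonianPath iso = bijection , Equivalence.from (adjacency _ _)
  where open _≅_ iso

≅C⇒hamiltonianPath : .(3≤n : 3 ≤ n) {F : Graph (Fin n)} → F ≅ C n 3≤n → HamiltonianPath F
≅C⇒hamiltonianPath 3≤n iso = bijection , Equivalence.from (adjacency _ _) ∘ ⊎-map inj₁ inj₁
  where open _≅_ iso

-- Domination by a colour class

∈-tabulate⁺ : {c : Fin n → Bool} {v : Fin n} → c v ≡ true → v ∈ tabulate c
∈-tabulate⁺ {c = c} {v} e = lookup⇒[]= v _ (trans (lookup∘tabulate c v) e)

γsd-≤ : (F₁ F₂ : Graph (Fin n)) {S : Subset n} → SimultaneouslyDominating F₁ F₂ S →
        γsd F₁ F₂ ≤ ∣ S ∣
γsd-≤ F₁ F₂ = proj₂ (proj₂ (γsd-exists F₁ F₂)) _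

half : ∀ {k} → k * 2 ≡ n → k ≡ n / 2
half {k = k} refl = sym (m*n/n≡m k 2)

even-bound : (F₁ F₂ : Graph (Fin n)) → n % 2 ≡ 0 →
             HamiltonianPath F₁ → HamiltonianPath F₂ → γsd F₁ F₂ ≤ n / 2
even-bound {n} F₁ F₂ even (π₁ , path₁) (π₂ , path₂) =
  let c , alt₁ , alt₂ = alternating (isMatching π₁) (isMatching π₂)
  in ≤-trans (γsd-≤ F₁ F₂ (dominates F₁ π₁ path₁ c alt₁ , dominates F₂ π₂ path₂ c alt₂))
             (≤-reflexive (half (trans (cong (_* 2) (∣tabulate∣≡sum c))
                                       (alternating-sum (isMatching π₁) alt₁))))
  where
  isMatching : (π : Permutation n n) → IsFixedPointFreeInvolution (conjugate π partner)
  isMatching π = conjugate-isFixedPointFreeInvolution π (partner-isFixedPointFreeInvolution even)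

  dominates : (F : Graph (Fin n)) (π : Permutation n n) →
              (∀ {u v} → Adj (P n) (π ⟨$⟩ʳ u) (π ⟨$⟩ʳ v) → Adj F u v) →
              (c : Fin n → Bool) → Alternates c (conjugate π partner) →
              Dominating F (tabulate c)
  dominates F π path c alt v v∉S =
    -- A vertex outside the class is coloured `false`, so its matching partner is `true` and
    -- dominates it.
    conjugate π partner v ,
    ∈-tabulate⁺ (trans (alt v) (cong not (¬-not (v∉S ∘ ∈-tabulate⁺)))) ,
    path (conjugate-partner-adjacent even π v)

-- Complementing a colouring preserves alternation, so the colour of one vertex can be prescribed.
avoiding-zero : {a b : Fin (suc n) → Fin (suc n)} →
  ∃[ c ] (Alternates c a × Alternates c b) →
  ∃[ c ] (c zero ≡ false × Alternates c a × Alternates c b)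
avoiding-zero (c , altA , altB) with c zero in eq
... | false = c , eq , altA , altB
... | true  = not ∘ c , cong not eq , cong not ∘ altA , cong not ∘ altB

-- The added vertex is `zero`: `lift₀ π` places it before the first vertex of either path. The
-- `true` class avoids it, so the whole class, half of the `suc n` vertices, lies in the original
-- graph.
odd-bound : (F₁ F₂ : Graph (Fin n)) → suc n % 2 ≡ 0 →
            HamiltonianPath F₁ → HamiltonianPath F₂ → γsd F₁ F₂ ≤ suc n / 2
odd-bound {n} F₁ F₂ even (π₁ , path₁) (π₂ , path₂) =
  let c , c0 , alt₁ , alt₂ = avoiding-zero (alternating (isMatching π₁) (isMatching π₂))
  in ≤-trans (γsd-≤ F₁ F₂ (dominates F₁ π₁ path₁ c c0 alt₁ , dominates F₂ π₂ path₂ c c0 alt₂))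
             (≤-reflexive (half (trans (cong (_* 2) (size c c0))
                                       (alternating-sum (isMatching π₁) alt₁))))
  where
  matching : Permutation n n → Fin (suc n) → Fin (suc n)
  matching π = conjugate (lift₀ π) partner

  isMatching : (π : Permutation n n) → IsFixedPointFreeInvolution (matching π)
  isMatching π =
    conjugate-isFixedPointFreeInvolution (lift₀ π) (partner-isFixedPointFreeInvolution even)

  size : (c : Fin (suc n) → Bool) → c zero ≡ false →
         ∣ tabulate (c ∘ suc) ∣ ≡ sum (indicator ∘ c)
  size c c0 = trans (∣tabulate∣≡sum (c ∘ suc))
                    (cong (λ t → indicator t + sum (indicator ∘ c ∘ suc)) (sym c0))

  dominates : (F : Graph (Fin n)) (π : Permutation n n) →
              (∀ {u v} → Adj (P n) (π ⟨$⟩ʳ u) (π ⟨$⟩ʳ v) → Adj F u v) →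
              (c : Fin (suc n) → Bool) → c zero ≡ false → Alternates c (matching π) →
              Dominating F (tabulate (c ∘ suc))
  dominates F π path c c0 alt v v∉S
    with matching π (suc v) | conjugate-partner-adjacent even (lift₀ π) (suc v)
       | trans (alt (suc v)) (cong not (¬-not (v∉S ∘ ∈-tabulate⁺)))
  -- The partner is coloured `true`, whereas the added vertex is `false`; hence the partner is an
  -- original vertex.
  ... | zero  | _   | c0′ = contradiction (trans (sym c0) c0′) λ ()
  ... | suc w | adj | cw  = w , ∈-tabulate⁺ cw , path (P-unsuc adj)

-- Assembling the even and odd cases

odd⇒suc-even : ∀ n → n % 2 ≡ 1 → suc n % 2 ≡ 0
odd⇒suc-even (suc zero)    _   = refl
odd⇒suc-even (suc (suc n)) odd = odd⇒suc-even n odd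

theorem22 : (∀ (n : ℕ) → n % 2 ≡ 0 → (4≤n : 4 ≤ n) →
    (∀ (F₁ F₂ : Graph (Fin n)) →
    F₁ ≅ C n (m+n≤o⇒n≤o 1 4≤n) → F₂ ≅ C n (m+n≤o⇒n≤o 1 4≤n) →
    γsd F₁ F₂ ≤ n / 2)
    ×
    (∀ (F₁ F₂ : Graph (Fin n)) →
    F₁ ≅ P n → F₂ ≅ P n →
    γsd F₁ F₂ ≤ n / 2))
    ×
    (∀ (n : ℕ) → n % 2 ≡ 1 → (5≤n : 5 ≤ n) →
    (∀ (F₁ F₂ : Graph (Fin n)) →
    F₁ ≅ C n (m+n≤o⇒n≤o 2 5≤n) → F₂ ≅ C n (m+n≤o⇒n≤o 2 5≤n) →
    γsd F₁ F₂ ≤ (n + 1) / 2))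
theorem22 =
  (λ n even 4≤n →
    (λ F₁ F₂ iso₁ iso₂ → even-bound F₁ F₂ even
       (≅C⇒hamiltonianPath (m+n≤o⇒n≤o 1 4≤n) iso₁) (≅C⇒hamiltonianPath (m+n≤o⇒n≤o 1 4≤n) iso₂)) ,
    (λ F₁ F₂ iso₁ iso₂ → even-bound F₁ F₂ even
       (≅P⇒hamiltonianPath iso₁) (≅P⇒hamiltonianPath iso₂))) ,
  (λ n odd 5≤n F₁ F₂ iso₁ iso₂ →
    subst (λ k → γsd F₁ F₂ ≤ k / 2) (+-comm 1 n)
      (odd-bound F₁ F₂ (odd⇒suc-even n odd)
        (≅C⇒hamiltonianPath (m+n≤o⇒n≤o 2 5≤n) iso₁) (≅C⇒hamiltonianPath (m+n≤o⇒n≤o 2 5≤n) iso₂)))
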